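{- Let $\mathcal{F}$ be an $n$-periodic tame frieze ($n\ge 1$, not necessarily the minimal period) and let $\mathcal{L}=(m_{i,j})_{i,j\in\mathbb{Z}}$ be its lattice. Then $$m_{1,n}-m_{2,n-1}=m_{k+1,k+n}-m_{k+2,k+n-1}$$ for all $k\in\mathbb{Z}$.
   Context: A frieze is an array $\mathcal{F}=(m_{i,j})$ of real numbers, with $i\in\mathbb{Z}$, whose rows are the sets of positions with $j-i$ constant, such that $m_{i,i-2}=0$ and $m_{i,i-1}=1$ for all $i$, and such that $m_{i,j}m_{i+1,j+1}-m_{i,j+1}m_{i+1,j}=1$ whenever all four entries lie in the array. It is infinite if it is indexed by all $(i,j)$ with $j-i\ge -2$; it is finite if it is indexed by all $(i,j)$ with $-2\le j-i\le N-2$ for some integer $N\ge 3$ and ends with a row of ones followed by a row of zeros: $m_{i,i+N-3}=1$ and $m_{i,i+N-2}=0$ for all $i$. The quiddity row is $(a_i)_{i\in\mathbb{Z}}$ with $a_i=m_{i,i}$. The frieze is tame if every $3\times 3$ matrix $\begin{pmatrix} m_{i,j}&m_{i+1,j}&m_{i+2,j}\\ m_{i,j+1}&m_{i+1,j+1}&m_{i+2,j+1}\\ m_{i,j+2}&m_{i+1,j+2}&m_{i+2,j+2}\end{pmatrix}$ of entries of the array has determinant $0$. It is $n$-periodic if $m_{i+n,j+n}=m_{i,j}$ for all entries. The lattice $\mathcal{L}=(m_{i,j})_{i,j\in\mathbb{Z}}$ of $\mathcal{F}$ is the extension of $\mathcal{F}$ to all of $\mathbb{Z}^2$ by anti-symmetric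 mirroring across rows of zeros: if $\mathcal{F}$ is infinite, $m_{i,j}=-m_{j+2,i-2}$ for $j-i<-2$; if $\mathcal{F}$ is finite, $\mathcal{L}$ is the unique extension satisfying $m_{i,j}=-m_{j+2,i-2}$ and $m_{i,j}=-m_{j-N+2,i+N-2}$ for all $i,j\in\mathbb{Z}$. -}

module Defs where

open import Level as Level using (Level; _⊔_)
open import Algebra.Apartness.Bundles using (HeytingCommutativeRing; HeytingField)
open import Algebra.Bundles using (CommutativeRing)
open import Data.Fin.Base using (Fin; zero; suc; toℕ)
open import Data.Integer.Base as ℤ using (ℤ; +_)
open import Data.Nat.Base as ℕ using (ℕ)
open import Data.Product.Base using (∃; _×_)
open import Data.Sum.Base using (_⊎_)
open import Data.Unit.Polymorphic.Base using (⊤)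
open import Function.Bundles using (_⇔_)
open import Relation.Binary.Core using (Rel)
open import Relation.Binary.Structures using (IsStrictPartialOrder)
import Algebra.Definitions.RawMonoid as Multiples

-- The standard library has no real numbers, so they are specified by their
-- usual axioms: a model is a Cauchy-complete Archimedean ordered field.  The
-- axioms are phrased constructively (apartness instead of ≉, cotransitivity
-- instead of trichotomy).  Read classically, they determine ℝ up to unique
-- isomorphism; the setoid of regular Cauchy sequences of rationals is a model
-- constructively.

record RealNumbers (c ℓ₁ ℓ₂ ℓ₃ : Level) : Set (Level.suc (c ⊔ ℓ₁ ⊔ ℓ₂ ⊔ ℓ₃)) where
  infix 4 _<_

  field
    heytingField : HeytingField c ℓ₁ ℓ₂

  open HeytingField heytingField public

  commutativeRing : CommutativeRing c ℓ₁
  commutativeRing = HeytingCommutativeRing.commutativeRing heytingCommutativeRing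

  open Multiples (CommutativeRing.+-rawMonoid commutativeRing) public
    using () renaming (_×_ to _·_)

  field
    _<_                  : Rel Carrier ℓ₃
    isStrictPartialOrder : IsStrictPartialOrder _≈_ _<_
    #⇔<⊎>                : ∀ x y → (x # y) ⇔ (x < y ⊎ y < x)
    +-monoʳ-<            : ∀ z {x y} → x < y → z + x < z + y
    *-positive           : ∀ {x y} → 0# < x → 0# < y → 0# < x * y
    archimedean          : ∀ x → ∃ λ (n : ℕ) → x < n · 1#

  -- ∣ x - y ∣ < ε
  Close : Carrier → Carrier → Carrier → Set ℓ₃
  Close ε x y = (- ε < x - y) × (x - y < ε)

  IsCauchy : (ℕ → Carrier) → Set (c ⊔ ℓ₃)
  IsCauchy s = ∀ ε → 0# < ε → ∃ λ (K : ℕ) → ∀ p q → K ℕ.≤ p → K ℕ.≤ q → Close ε (s p) (s q)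

  _ConvergesTo_ : (ℕ → Carrier) → Carrier → Set (c ⊔ ℓ₃)
  s ConvergesTo x = ∀ ε → 0# < ε → ∃ λ (K : ℕ) → ∀ p → K ℕ.≤ p → Close ε (s p) x

  field
    complete : ∀ s → IsCauchy s → ∃ λ x → s ConvergesTo x

data Shape : Set where
  infinite : Shape
  finite   : (N : ℕ) → 3 ℕ.≤ N → Shape

InArray : Shape → ℤ → ℤ → Set
InArray infinite     i j = ℤ.- (+ 2) ℤ.≤ j ℤ.- i
InArray (finite N _) i j = (ℤ.- (+ 2) ℤ.≤ j ℤ.- i) × (j ℤ.- i ℤ.≤ + N ℤ.- + 2)

module _ {c ℓ₁ ℓ₂ ℓ₃ : Level} (ℝ : RealNumbers c ℓ₁ ℓ₂ ℓ₃) where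
  open RealNumbers ℝ using (Carrier; _≈_; _+_; _*_; _-_; -_; 0#; 1#)

  -- Entries exist only at positions of the array; the irrelevant argument makes
  -- an entry depend on its position alone.
  Array : Shape → Set c
  Array s = ∀ i j → .(InArray s i j) → Carrier

  EndsWithOnesThenZeros : ∀ s → Array s → Set ℓ₁
  EndsWithOnesThenZeros infinite     m = ⊤
  EndsWithOnesThenZeros (finite N h) m =
    (∀ i (p : InArray (finite N h) i (i ℤ.+ + N ℤ.- + 3)) → m i (i ℤ.+ + N ℤ.- + 3) p ≈ 1#) ×
    (∀ i (p : InArray (finite N h) i (i ℤ.+ + N ℤ.- + 2)) → m i (i ℤ.+ + N ℤ.- + 2) p ≈ 0#)

  -- In every field below the hypotheses of the form InArray s i j say that the
  -- entries mentioned lie in the array.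
  record Frieze (s : Shape) : Set (c ⊔ ℓ₁) where
    field
      entry : Array s
      zeros : ∀ i (p : InArray s i (i ℤ.- + 2)) → entry i (i ℤ.- + 2) p ≈ 0#
      ones  : ∀ i (p : InArray s i (i ℤ.- + 1)) → entry i (i ℤ.- + 1) p ≈ 1#
      rule  : ∀ i j
              (p₁ : InArray s i           j)
              (p₂ : InArray s (i ℤ.+ + 1) (j ℤ.+ + 1))
              (p₃ : InArray s i           (j ℤ.+ + 1))
              (p₄ : InArray s (i ℤ.+ + 1) j) →
              entry i j p₁ * entry (i ℤ.+ + 1) (j ℤ.+ + 1) p₂
                - entry i (j ℤ.+ + 1) p₃ * entry (i ℤ.+ + 1) j p₄ ≈ 1#
      end   : EndsWithOnesThenZeros s entry

  open Frieze

  det₃ : (Fin 3 → Fin 3 → Carrier) → Carrier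
  det₃ A = A r₀ r₀ * (A r₁ r₁ * A r₂ r₂ - A r₁ r₂ * A r₂ r₁)
         - A r₀ r₁ * (A r₁ r₀ * A r₂ r₂ - A r₁ r₂ * A r₂ r₀)
         + A r₀ r₂ * (A r₁ r₀ * A r₂ r₁ - A r₁ r₁ * A r₂ r₀)
    where
    r₀ r₁ r₂ : Fin 3
    r₀ = zero
    r₁ = suc zero
    r₂ = suc (suc zero)

  -- In the 3 × 3 blocks the first index of an entry increases from left to right
  -- and the second from top to bottom.
  Tame : ∀ {s} → Frieze s → Set ℓ₁
  Tame {s} F =
    ∀ i j (p : (row col : Fin 3) → InArray s (i ℤ.+ + toℕ col) (j ℤ.+ + toℕ row)) →
    det₃ (λ row col → entry F (i ℤ.+ + toℕ col) (j ℤ.+ + toℕ row) (p row col)) ≈ 0#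

  Periodic : ∀ {s} → ℕ → Frieze s → Set ℓ₁
  Periodic {s} n F =
    ∀ i j (p : InArray s i j) (q : InArray s (i ℤ.+ + n) (j ℤ.+ + n)) →
    entry F (i ℤ.+ + n) (j ℤ.+ + n) q ≈ entry F i j p

  Mirrors : Shape → (ℤ → ℤ → Carrier) → Set ℓ₁
  Mirrors infinite     m =
    ∀ i j → j ℤ.- i ℤ.< ℤ.- (+ 2) → m i j ≈ - m (j ℤ.+ + 2) (i ℤ.- + 2)
  Mirrors (finite N _) m =
    (∀ i j → m i j ≈ - m (j ℤ.+ + 2) (i ℤ.- + 2)) ×
    (∀ i j → m i j ≈ - m (j ℤ.- + N ℤ.+ + 2) (i ℤ.+ + N ℤ.- + 2))

  -- The mirror relations determine the extension uniquely, so "m is the lattice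
  -- of F" is a property of m.
  record IsLattice {s : Shape} (F : Frieze s) (m : ℤ → ℤ → Carrier) : Set ℓ₁ where
    field
      extends : ∀ i j (p : InArray s i j) → m i j ≈ entry F i j p
      mirrors : Mirrors s m

{-# OPTIONS --safe #-}

-- Write w i δ = m i (i + δ - 2), so that the rows are δ = 0 (zeros), δ = 1
-- (ones), δ = 2 (quiddity), and so on.  Since adjacent 2 × 2 minors are 1, tameness
-- forces the linear recurrences
--   w i (2 + δ) + w i δ       = a (i + δ) * w i (1 + δ),
--   w i (2 + δ) + w (i + 2) δ = a i * w (i + 1) (1 + δ),
-- and for δ = n - 1 their difference at neighbouring positions is the claim, because
-- a (i + n) = a i.  In a finite frieze of width N this covers n < N.  The two
-- recurrences also give the glide symmetry w i δ = w (i + δ) (N - δ), whence the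
-- lattice satisfies w i (δ + N) = - w i δ; so the difference is -2 for n = N, and a
-- larger n may be lowered by N.

module Submission where

open import Defs
open import Level using (Level)
open import Algebra.Bundles using (CommutativeRing)
open import Data.Fin.Base using (Fin; zero; suc; toℕ; opposite)
open import Data.Fin.Properties using (toℕ≤pred[n])
open import Data.Integer.Base as ℤ using (ℤ; +_; -[1+_])
import Data.Integer.Properties as ℤ
open import Data.Integer.Tactic.RingSolver using (solve-∀)
open import Data.Nat.Base as ℕ using (ℕ; zero; suc; NonZero; z≤n; s≤s)
import Data.Nat.Properties as ℕ
open import Data.Nat.Induction using (<-wellFounded)
open import Data.Product.Base using (_×_; _,_; proj₁; proj₂)
open import Data.Unit.Base using (⊤; tt)
open import Induction.WellFounded using (Acc; acc)
open import Relation.Binary.Definitions using (tri<; tri≈; tri>)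
open import Relation.Binary.PropositionalEquality as ≡ using (_≡_)
open import Relation.Nullary.Decidable using (yes; no)

-- Integer shifts by natural numbers.

shift : ℕ → ℤ → ℤ
shift zero    i = i
-- Recursing on the argument makes `shift δ (shift 1 i)` and `shift (1 + δ) i` definitionally equal,
-- so the coefficients in the induction of `rightward` match without transport.
shift (suc δ) i = shift δ (ℤ.suc i)

shift-shift : ∀ δ ε i → shift ε (shift δ i) ≡ shift (δ ℕ.+ ε) i
shift-shift zero    ε i = ≡.refl
shift-shift (suc δ) ε i = shift-shift δ ε (ℤ.suc i)

shift-comm : ∀ δ ε i → shift ε (shift δ i) ≡ shift δ (shift ε i)
shift-comm δ ε i = ≡.trans (shift-shift δ ε i)
  (≡.trans (≡.cong (λ n → shift n i) (ℕ.+-comm δ ε)) (≡.sym (shift-shift ε δ i)))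

shift≡+ : ∀ δ i → shift δ i ≡ i ℤ.+ + δ
shift≡+ zero    i = ≡.sym (ℤ.+-identityʳ i)
shift≡+ (suc δ) i = ≡.trans (shift≡+ δ (ℤ.suc i)) (move i (+ δ))
  where
  move : ∀ i d → + 1 ℤ.+ i ℤ.+ d ≡ i ℤ.+ (+ 1 ℤ.+ d)
  move = solve-∀

-- Elimination in singular 3 × 3 matrices over a commutative ring.

module FriezeRows {c ℓ : Level} (R : CommutativeRing c ℓ) where
  open CommutativeRing R hiding (zero)
  open import Algebra.Properties.Group +-group
    using (⁻¹-involutive; x∙y⁻¹≈ε⇒x≈y; //-rightDividesˡ) renaming (∙-cancelʳ to +-cancelʳ)
  open import Algebra.Properties.AbelianGroup +-abelianGroup using (⁻¹-∙-comm)
  open import Algebra.Solver.Ring.NaturalCoefficients.Default commutativeSemiring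
    using (solve; _:+_; _:*_; _:=_; con)
  open import Relation.Binary.Reasoning.Setoid setoid

  constant : ∀ (f : ℤ → Carrier) → (∀ i → f (ℤ.suc i) ≈ f i) → ∀ i → f i ≈ f (+ 0)
  constant f step (+ zero)     = refl
  constant f step (+ suc n)    = trans (step (+ n)) (constant f step (+ n))
  constant f step -[1+ zero ]  = sym (step -[1+ zero ])
  constant f step -[1+ suc n ] = trans (sym (step -[1+ suc n ])) (constant f step -[1+ n ])

  x-y≈z⇒x≈z+y : ∀ {x y z} → x - y ≈ z → x ≈ z + y
  x-y≈z⇒x≈z+y {x} {y} x-y≈z = trans (sym (//-rightDividesˡ y x)) (+-congʳ x-y≈z)

  x+y≈z+t⇒x-t≈z-y : ∀ {x y z t} → x + y ≈ z + t → x - t ≈ z - y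
  x+y≈z+t⇒x-t≈z-y {x} {y} {z} {t} eq = begin
    x - t                     ≈⟨ +-identityʳ _ ⟨
    x - t + 0#                ≈⟨ +-congˡ (-‿inverseʳ y) ⟨
    x - t + (y - y)           ≈⟨ swap x (- t) y (- y) ⟩
    x + y + (- t + - y)       ≈⟨ +-congʳ eq ⟩
    z + t + (- t + - y)       ≈⟨ swap' z t (- t) (- y) ⟩
    z - y + (t - t)           ≈⟨ +-congˡ (-‿inverseʳ t) ⟩
    z - y + 0#                ≈⟨ +-identityʳ _ ⟩
    z - y                     ∎
    where
    swap : ∀ a b c d → (a + b) + (c + d) ≈ (a + c) + (b + d)
    swap = solve 4 (λ a b c d → (a :+ b) :+ (c :+ d) := (a :+ c) :+ (b :+ d)) refl
    swap' : ∀ a b c d → (a + b) + (c + d) ≈ (a + d) + (b + c)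
    swap' = solve 4 (λ a b c d → (a :+ b) :+ (c :+ d) := (a :+ d) :+ (b :+ c)) refl

  -- The determinant of the matrix with rows p, q, r vanishes; the terms are moved
  -- so that no subtraction occurs.
  Singular : (p₀ p₁ p₂ q₀ q₁ q₂ r₀ r₁ r₂ : Carrier) → Set ℓ
  Singular p₀ p₁ p₂ q₀ q₁ q₂ r₀ r₁ r₂ =
    p₀ * q₁ * r₂ + p₁ * q₂ * r₀ + p₂ * q₀ * r₁ ≈ p₀ * q₂ * r₁ + p₁ * q₀ * r₂ + p₂ * q₁ * r₀

  -- The identities given to `solve` are semiring identities. The 2 × 2 minors therefore enter as
  -- atoms `m₀`, `m₁`, `m₂`, each tied to its products by an equation without subtraction.
  det≈0⇒singular : ∀ {p₀ p₁ p₂ q₀ q₁ q₂ r₀ r₁ r₂} →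
    p₀ * (q₁ * r₂ - q₂ * r₁) - p₁ * (q₀ * r₂ - q₂ * r₀) + p₂ * (q₀ * r₁ - q₁ * r₀) ≈ 0# →
    Singular p₀ p₁ p₂ q₀ q₁ q₂ r₀ r₁ r₂
  det≈0⇒singular {p₀} {p₁} {p₂} {q₀} {q₁} {q₂} {r₀} {r₁} {r₂} det = begin
    p₀ * q₁ * r₂ + p₁ * q₂ * r₀ + p₂ * q₀ * r₁
      ≈⟨ +-cong (+-congʳ (trans (*-assoc _ _ _) (*-congˡ t₀))) (trans (*-assoc _ _ _) (*-congˡ t₂)) ⟩
    p₀ * (m₀ + q₂ * r₁) + p₁ * q₂ * r₀ + p₂ * (m₂ + q₁ * r₀)
      ≈⟨ solve 11 (λ p₀ p₁ p₂ q₀ q₁ q₂ r₀ r₁ r₂ m₀ m₂ →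
           p₀ :* (m₀ :+ q₂ :* r₁) :+ p₁ :* q₂ :* r₀ :+ p₂ :* (m₂ :+ q₁ :* r₀) :=
           (p₀ :* m₀ :+ p₂ :* m₂) :+ (p₁ :* q₂ :* r₀ :+ p₀ :* q₂ :* r₁ :+ p₂ :* q₁ :* r₀))
           refl p₀ p₁ p₂ q₀ q₁ q₂ r₀ r₁ r₂ m₀ m₂ ⟩
    (p₀ * m₀ + p₂ * m₂) + (p₁ * q₂ * r₀ + p₀ * q₂ * r₁ + p₂ * q₁ * r₀)
      ≈⟨ +-congʳ balance ⟩
    p₁ * m₁ + (p₁ * q₂ * r₀ + p₀ * q₂ * r₁ + p₂ * q₁ * r₀)
      ≈⟨ solve 9 (λ p₀ p₁ p₂ q₁ q₂ r₀ r₁ r₂ m₁ →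
           p₁ :* m₁ :+ (p₁ :* q₂ :* r₀ :+ p₀ :* q₂ :* r₁ :+ p₂ :* q₁ :* r₀) :=
           p₀ :* q₂ :* r₁ :+ p₁ :* (m₁ :+ q₂ :* r₀) :+ p₂ :* q₁ :* r₀)
           refl p₀ p₁ p₂ q₁ q₂ r₀ r₁ r₂ m₁ ⟩
    p₀ * q₂ * r₁ + p₁ * (m₁ + q₂ * r₀) + p₂ * q₁ * r₀
      ≈⟨ +-congʳ (+-congˡ (trans (*-assoc _ _ _) (*-congˡ t₁))) ⟨
    p₀ * q₂ * r₁ + p₁ * q₀ * r₂ + p₂ * q₁ * r₀ ∎
    where
    m₀ m₁ m₂ : Carrier
    m₀ = q₁ * r₂ - q₂ * r₁
    m₁ = q₀ * r₂ - q₂ * r₀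
    m₂ = q₀ * r₁ - q₁ * r₀
    t₀ : q₁ * r₂ ≈ m₀ + q₂ * r₁
    t₀ = x-y≈z⇒x≈z+y refl
    t₁ : q₀ * r₂ ≈ m₁ + q₂ * r₀
    t₁ = x-y≈z⇒x≈z+y refl
    t₂ : q₀ * r₁ ≈ m₂ + q₁ * r₀
    t₂ = x-y≈z⇒x≈z+y refl
    balance : p₀ * m₀ + p₂ * m₂ ≈ p₁ * m₁
    balance = x∙y⁻¹≈ε⇒x≈y _ _ (trans
      (solve 3 (λ a b c → a :+ b :+ c := a :+ c :+ b) refl (p₀ * m₀) (p₂ * m₂) (- (p₁ * m₁)))
      det)

  -- Adding the other rows to r - c * q + p leaves (x , 0 , 0), and the cofactor of
  -- x is 1.
  singular⇒recurrence : ∀ {c p₀ p₁ p₂ q₀ q₁ q₂ r₀ r₁ r₂} →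
    Singular p₀ p₁ p₂ q₀ q₁ q₂ r₀ r₁ r₂ → p₁ * q₂ ≈ 1# + q₁ * p₂ →
    r₁ + p₁ ≈ c * q₁ → r₂ + p₂ ≈ c * q₂ → r₀ + p₀ ≈ c * q₀
  singular⇒recurrence {c} {p₀} {p₁} {p₂} {q₀} {q₁} {q₂} {r₀} {r₁} {r₂} sing uni e₁ e₂ =
    -- The cancelled sum completes both sides: `r₀ + p₀` and `c * q₀` each become multiples of
    -- `1# + v`, that is of `p₁ * q₂`, and the remaining products are those that `e₁` and `e₂`
    -- rewrite.
    +-cancelʳ (r₀ * v + p₀ * v + c * q₀ * v + c * p₀ * q₁ * q₂) _ _ (begin
      r₀ + p₀ + (r₀ * v + p₀ * v + c * q₀ * v + c * p₀ * q₁ * q₂)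
        ≈⟨ solve 7 (λ c p₀ p₂ q₀ q₁ q₂ r₀ →
             r₀ :+ p₀ :+ (r₀ :* (q₁ :* p₂) :+ p₀ :* (q₁ :* p₂) :+ c :* q₀ :* (q₁ :* p₂)
               :+ c :* p₀ :* q₁ :* q₂) :=
             (r₀ :+ p₀) :* (con 1 :+ q₁ :* p₂) :+ q₀ :* p₂ :* (c :* q₁) :+ p₀ :* q₁ :* (c :* q₂))
             refl c p₀ p₂ q₀ q₁ q₂ r₀ ⟩
      (r₀ + p₀) * (1# + v) + q₀ * p₂ * (c * q₁) + p₀ * q₁ * (c * q₂)
        ≈⟨ +-cong (+-cong (*-congˡ uni) (*-congˡ e₁)) (*-congˡ e₂) ⟨
      (r₀ + p₀) * (p₁ * q₂) + q₀ * p₂ * (r₁ + p₁) + p₀ * q₁ * (r₂ + p₂)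
        ≈⟨ solve 9 (λ p₀ p₁ p₂ q₀ q₁ q₂ r₀ r₁ r₂ →
             (r₀ :+ p₀) :* (p₁ :* q₂) :+ q₀ :* p₂ :* (r₁ :+ p₁) :+ p₀ :* q₁ :* (r₂ :+ p₂) :=
             (p₀ :* q₁ :* r₂ :+ p₁ :* q₂ :* r₀ :+ p₂ :* q₀ :* r₁)
               :+ (p₀ :* p₁ :* q₂ :+ p₁ :* p₂ :* q₀ :+ p₀ :* p₂ :* q₁))
             refl p₀ p₁ p₂ q₀ q₁ q₂ r₀ r₁ r₂ ⟩
      (p₀ * q₁ * r₂ + p₁ * q₂ * r₀ + p₂ * q₀ * r₁) + (p₀ * p₁ * q₂ + p₁ * p₂ * q₀ + p₀ * p₂ * q₁)
        -- Replacing row `r` by `r + p` preserves the determinant: either half of its expansion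
        -- gains the same three products, each with two factors from `p`.
        ≈⟨ +-congʳ sing ⟩
      (p₀ * q₂ * r₁ + p₁ * q₀ * r₂ + p₂ * q₁ * r₀) + (p₀ * p₁ * q₂ + p₁ * p₂ * q₀ + p₀ * p₂ * q₁)
        ≈⟨ solve 9 (λ p₀ p₁ p₂ q₀ q₁ q₂ r₀ r₁ r₂ →
             (p₀ :* q₂ :* r₁ :+ p₁ :* q₀ :* r₂ :+ p₂ :* q₁ :* r₀)
               :+ (p₀ :* p₁ :* q₂ :+ p₁ :* p₂ :* q₀ :+ p₀ :* p₂ :* q₁) :=
             p₀ :* q₂ :* (r₁ :+ p₁) :+ q₀ :* p₁ :* (r₂ :+ p₂) :+ (r₀ :+ p₀) :* (q₁ :* p₂))
             refl p₀ p₁ p₂ q₀ q₁ q₂ r₀ r₁ r₂ ⟩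
      p₀ * q₂ * (r₁ + p₁) + q₀ * p₁ * (r₂ + p₂) + (r₀ + p₀) * v
        ≈⟨ +-congʳ (+-cong (*-congˡ e₁) (*-congˡ e₂)) ⟩
      p₀ * q₂ * (c * q₁) + q₀ * p₁ * (c * q₂) + (r₀ + p₀) * v
        ≈⟨ solve 8 (λ c p₀ p₁ q₀ q₁ q₂ r₀ v →
             p₀ :* q₂ :* (c :* q₁) :+ q₀ :* p₁ :* (c :* q₂) :+ (r₀ :+ p₀) :* v :=
             c :* q₀ :* (p₁ :* q₂) :+ (c :* p₀ :* q₁ :* q₂ :+ (r₀ :+ p₀) :* v))
             refl c p₀ p₁ q₀ q₁ q₂ r₀ v ⟩
      c * q₀ * (p₁ * q₂) + (c * p₀ * q₁ * q₂ + (r₀ + p₀) * v)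
        ≈⟨ +-congʳ (*-congˡ uni) ⟩
      c * q₀ * (1# + v) + (c * p₀ * q₁ * q₂ + (r₀ + p₀) * v)
        ≈⟨ solve 7 (λ c p₀ q₀ q₁ q₂ r₀ v →
             c :* q₀ :* (con 1 :+ v) :+ (c :* p₀ :* q₁ :* q₂ :+ (r₀ :+ p₀) :* v) :=
             c :* q₀ :+ (r₀ :* v :+ p₀ :* v :+ c :* q₀ :* v :+ c :* p₀ :* q₁ :* q₂))
             refl c p₀ q₀ q₁ q₂ r₀ v ⟩
      c * q₀ + (r₀ * v + p₀ * v + c * q₀ * v + c * p₀ * q₁ * q₂) ∎)
    where
    v : Carrier
    v = q₁ * p₂

  -- Reflection in the antidiagonal permutes the terms within each half of the expansion. It
  -- exchanges the two diagonal directions of a frieze, so one elimination serves both recurrences.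
  singular-antitranspose : ∀ {p₀ p₁ p₂ q₀ q₁ q₂ r₀ r₁ r₂} →
    Singular p₀ p₁ p₂ q₀ q₁ q₂ r₀ r₁ r₂ → Singular r₂ q₂ p₂ r₁ q₁ p₁ r₀ q₀ p₀
  singular-antitranspose {p₀} {p₁} {p₂} {q₀} {q₁} {q₂} {r₀} {r₁} {r₂} sing = begin
    r₂ * q₁ * p₀ + q₂ * p₁ * r₀ + p₂ * r₁ * q₀
      ≈⟨ solve 9 (λ p₀ p₁ p₂ q₀ q₁ q₂ r₀ r₁ r₂ →
           r₂ :* q₁ :* p₀ :+ q₂ :* p₁ :* r₀ :+ p₂ :* r₁ :* q₀ :=
           p₀ :* q₁ :* r₂ :+ p₁ :* q₂ :* r₀ :+ p₂ :* q₀ :* r₁)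
           refl p₀ p₁ p₂ q₀ q₁ q₂ r₀ r₁ r₂ ⟩
    p₀ * q₁ * r₂ + p₁ * q₂ * r₀ + p₂ * q₀ * r₁
      ≈⟨ sing ⟩
    p₀ * q₂ * r₁ + p₁ * q₀ * r₂ + p₂ * q₁ * r₀
      ≈⟨ solve 9 (λ p₀ p₁ p₂ q₀ q₁ q₂ r₀ r₁ r₂ →
           p₀ :* q₂ :* r₁ :+ p₁ :* q₀ :* r₂ :+ p₂ :* q₁ :* r₀ :=
           r₂ :* p₁ :* q₀ :+ q₂ :* r₁ :* p₀ :+ p₂ :* q₁ :* r₀)
           refl p₀ p₁ p₂ q₀ q₁ q₂ r₀ r₁ r₂ ⟩
    r₂ * p₁ * q₀ + q₂ * r₁ * p₀ + p₂ * q₁ * r₀ ∎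

  -- Tame friezes by rows and their linear recurrences.

  -- Band δ says that row δ belongs to the array.
  record IsTameFrieze (Band : ℕ → Set) (w : ℤ → ℕ → Carrier) : Set ℓ where
    field
      band-≤     : ∀ {δ ε} → δ ℕ.≤ ε → Band ε → Band δ
      zeros      : ∀ i → w i 0 ≈ 0#
      ones       : ∀ i → w i 1 ≈ 1#
      unimodular : ∀ δ i → Band (2 ℕ.+ δ) →
                   w i (1 ℕ.+ δ) * w (shift 1 i) (1 ℕ.+ δ) ≈ 1# + w i (2 ℕ.+ δ) * w (shift 1 i) δ
      tame       : ∀ δ i → Band (4 ℕ.+ δ) → Singular
                   (w i (2 ℕ.+ δ)) (w (shift 1 i) (1 ℕ.+ δ)) (w (shift 2 i) δ)
                   (w i (3 ℕ.+ δ)) (w (shift 1 i) (2 ℕ.+ δ)) (w (shift 2 i) (1 ℕ.+ δ))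
                   (w i (4 ℕ.+ δ)) (w (shift 1 i) (3 ℕ.+ δ)) (w (shift 2 i) (2 ℕ.+ δ))

  module TameFrieze {Band : ℕ → Set} {w : ℤ → ℕ → Carrier} (isTame : IsTameFrieze Band w) where
    open IsTameFrieze isTame

    -- Row 0 vanishes everywhere, so `j` is free and both recurrences can start here although their
    -- second terms sit at different positions.
    recurrence-row₀ : ∀ {i j} → w i 2 + w j 0 ≈ w i 2 * 1#
    recurrence-row₀ {i} {j} = begin
      w i 2 + w j 0   ≈⟨ +-congˡ (zeros j) ⟩
      w i 2 + 0#      ≈⟨ +-identityʳ _ ⟩
      w i 2           ≈⟨ *-identityʳ _ ⟨
      w i 2 * 1#      ∎

    recurrence-row₁ : ∀ {i j} → Band 3 → w i 3 + w j 1 ≈ w i 2 * w (shift 1 i) 2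
    recurrence-row₁ {i} {j} b = begin
      w i 3 + w j 1                   ≈⟨ +-cong (sym (*-identityʳ _)) (ones j) ⟩
      w i 3 * 1# + 1#                 ≈⟨ +-congʳ (*-congˡ (ones (shift 1 i))) ⟨
      w i 3 * w (shift 1 i) 1 + 1#    ≈⟨ +-comm _ _ ⟩
      1# + w i 3 * w (shift 1 i) 1    ≈⟨ unimodular 1 i b ⟨
      w i 2 * w (shift 1 i) 2         ∎

    rightward : ∀ δ i → Band (2 ℕ.+ δ) →
      w i (2 ℕ.+ δ) + w i δ ≈ w (shift δ i) 2 * w i (1 ℕ.+ δ)
    rightward zero          i b = trans recurrence-row₀ (*-congˡ (sym (ones i)))
    rightward (suc zero)    i b = trans (recurrence-row₁ b) (*-comm _ _)
    -- The induction hypotheses are the recurrence in the second and third columns of the tame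
    -- block, with the same coefficient; tameness carries it to the first column.
    rightward (suc (suc δ)) i b = singular⇒recurrence (tame δ i b)
      (unimodular δ (shift 1 i) b₂) (rightward (suc δ) (shift 1 i) b₃) (rightward δ (shift 2 i) b₂)
      where
      b₃ : Band (3 ℕ.+ δ)
      b₃ = band-≤ (ℕ.n≤1+n _) b
      b₂ : Band (2 ℕ.+ δ)
      b₂ = band-≤ (ℕ.n≤1+n _) b₃

    leftward : ∀ δ i → Band (2 ℕ.+ δ) →
      w i (2 ℕ.+ δ) + w (shift 2 i) δ ≈ w i 2 * w (shift 1 i) (1 ℕ.+ δ)
    leftward zero          i b = trans recurrence-row₀ (*-congˡ (sym (ones (shift 1 i))))
    leftward (suc zero)    i b = recurrence-row₁ b
    -- After the reflection the columns of the block are its former rows, and the recurrence with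
    -- coefficient `w i 2` is known in two of them.
    leftward (suc (suc δ)) i b = singular⇒recurrence (singular-antitranspose (tame δ i b))
      (trans (*-comm _ _) (unimodular δ (shift 1 i) b₂)) (leftward (suc δ) i b₃) (leftward δ i b₂)
      where
      b₃ : Band (3 ℕ.+ δ)
      b₃ = band-≤ (ℕ.n≤1+n _) b
      b₂ : Band (2 ℕ.+ δ)
      b₂ = band-≤ (ℕ.n≤1+n _) b₃

    -- In an `n`-periodic tame frieze with `n = 1 + δ` this is the growth coefficient, the trace of
    -- the product over one period of the matrices with rows (a, -1) and (1, 0).
    difference : ℕ → ℤ → Carrier
    difference δ i = w i (2 ℕ.+ δ) - w (ℤ.suc i) δ

    -- Both recurrences have a multiple of `w (shift 1 i) (1 + δ)` on the right; the period
    -- identifies the two coefficients, and the four remaining terms regroup into the differences.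
    difference-suc : ∀ δ i → Band (2 ℕ.+ δ) → w (shift (1 ℕ.+ δ) i) 2 ≈ w i 2 →
      difference δ (ℤ.suc i) ≈ difference δ i
    difference-suc δ i b period = x+y≈z+t⇒x-t≈z-y (begin
      w (shift 1 i) (2 ℕ.+ δ) + w (shift 1 i) δ        ≈⟨ rightward δ (shift 1 i) b ⟩
      w (shift (1 ℕ.+ δ) i) 2 * w (shift 1 i) (1 ℕ.+ δ) ≈⟨ *-congʳ period ⟩
      w i 2 * w (shift 1 i) (1 ℕ.+ δ)                  ≈⟨ leftward δ i b ⟨
      w i (2 ℕ.+ δ) + w (shift 2 i) δ                  ∎)

  -- Finite friezes: glide symmetry, antiperiodicity and lowering of the period.

  module FiniteLattice {K : ℕ} {w : ℤ → ℕ → Carrier}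
    (isTame      : IsTameFrieze (ℕ._≤ 3 ℕ.+ K) w)
    (last-ones   : ∀ i → w i (2 ℕ.+ K) ≈ 1#)
    (last-zeros  : ∀ i → w i (3 ℕ.+ K) ≈ 0#)
    (mirror      : ∀ δ ε i → δ ℕ.+ ε ≡ 3 ℕ.+ K → w i (δ ℕ.+ (3 ℕ.+ K)) ≈ - w (shift δ i) ε)
    (translation : ∀ δ i → w i (δ ℕ.+ (3 ℕ.+ K) ℕ.+ (3 ℕ.+ K)) ≈ w (shift (3 ℕ.+ K) i) δ)
    where
    open IsTameFrieze isTame using (zeros; ones)
    open TameFrieze isTame

    N : ℕ
    N = 3 ℕ.+ K

    -- As `δ` grows, both sides satisfy the same second-order recurrence with coefficient
    -- `w (shift δ i) 2`, one by `rightward` and the other by `leftward`. The boundary rows of zeros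
    -- and ones give equal initial values.
    glide : ∀ δ ε i → δ ℕ.+ ε ≡ N → w i δ ≈ w (shift δ i) ε
    glide zero          ε i ≡.refl = trans (zeros i) (sym (last-zeros i))
    glide (suc zero)    ε i ≡.refl = trans (ones i) (sym (last-ones (shift 1 i)))
    glide (suc (suc δ)) ε i δ+ε≡N  = +-cancelʳ (w i δ) _ _ (begin
      w i (2 ℕ.+ δ) + w i δ
        ≈⟨ rightward δ i (ℕ.≤-trans (ℕ.m≤m+n (2 ℕ.+ δ) ε) (ℕ.≤-reflexive δ+ε≡N)) ⟩
      w i′ 2 * w i (1 ℕ.+ δ)
        ≈⟨ *-congˡ (glide (suc δ) (suc ε) i 1+δ+1+ε≡N) ⟩
      w i′ 2 * w (shift δ (shift 1 i)) (1 ℕ.+ ε)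
        ≡⟨ ≡.cong (λ j → w i′ 2 * w j (1 ℕ.+ ε)) (shift-comm δ 1 i) ⟨
      w i′ 2 * w (shift 1 i′) (1 ℕ.+ ε)
        ≈⟨ leftward ε i′ (ℕ.≤-trans (ℕ.m≤n+m (2 ℕ.+ ε) δ) (ℕ.≤-reflexive δ+2+ε≡N)) ⟨
      w i′ (2 ℕ.+ ε) + w (shift 2 i′) ε
        ≈⟨ +-congʳ (glide δ (2 ℕ.+ ε) i δ+2+ε≡N) ⟨
      w i δ + w (shift 2 i′) ε
        ≈⟨ +-comm _ _ ⟩
      w (shift 2 i′) ε + w i δ
        ≡⟨ ≡.cong (λ j → w j ε + w i δ) (shift-comm δ 2 i) ⟩
      w (shift δ (shift 2 i)) ε + w i δ ∎)
      where
      i′ : ℤ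
      i′ = shift δ i
      1+δ+1+ε≡N : suc δ ℕ.+ suc ε ≡ N
      1+δ+1+ε≡N = ≡.trans (ℕ.+-suc (suc δ) ε) δ+ε≡N
      δ+2+ε≡N : δ ℕ.+ suc (suc ε) ≡ N
      δ+2+ε≡N = ≡.trans (ℕ.+-suc δ (suc ε)) 1+δ+1+ε≡N

    AntiperiodicRow PeriodicRow : ℕ → Set ℓ
    AntiperiodicRow δ = ∀ i → w i (δ ℕ.+ N) ≈ - w i δ
    PeriodicRow     δ = ∀ i → w (shift N i) δ ≈ w i δ

    -- Antiperiodicity is the mirror across row `N` undone by a glide; periodicity is the glide
    -- applied twice.
    rows-≤N : ∀ {δ} → δ ℕ.≤ N → AntiperiodicRow δ × PeriodicRow δ
    rows-≤N {δ} δ≤N = antiperiodic , periodic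
      where
      ε : ℕ
      ε = N ℕ.∸ δ
      δ+ε≡N : δ ℕ.+ ε ≡ N
      δ+ε≡N = ℕ.m+[n∸m]≡n δ≤N
      antiperiodic : AntiperiodicRow δ
      antiperiodic i = trans (mirror δ ε i δ+ε≡N) (-‿cong (sym (glide δ ε i δ+ε≡N)))
      periodic : PeriodicRow δ
      periodic i = begin
        w (shift N i) δ               ≡⟨ ≡.cong (λ n → w (shift n i) δ) δ+ε≡N ⟨
        w (shift (δ ℕ.+ ε) i) δ       ≡⟨ ≡.cong (λ j → w j δ) (shift-shift δ ε i) ⟨
        w (shift ε (shift δ i)) δ     ≈⟨ glide ε δ (shift δ i) (≡.trans (ℕ.+-comm ε δ) δ+ε≡N) ⟨
        w (shift δ i) ε               ≈⟨ glide δ ε i δ+ε≡N ⟨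
        w i δ                         ∎

    -- The two properties are carried together: `translation` lowers the row by twice `N` but moves
    -- the base point by `N`, and periodicity moves it back.
    rows-+N : ∀ {δ} → AntiperiodicRow δ × PeriodicRow δ →
      AntiperiodicRow (δ ℕ.+ N) × PeriodicRow (δ ℕ.+ N)
    rows-+N {δ} (antiperiodic , periodic) = antiperiodic′ , periodic′
      where
      antiperiodic′ : AntiperiodicRow (δ ℕ.+ N)
      antiperiodic′ i = begin
        w i (δ ℕ.+ N ℕ.+ N)   ≈⟨ translation δ i ⟩
        w (shift N i) δ       ≈⟨ periodic i ⟩
        w i δ                 ≈⟨ ⁻¹-involutive _ ⟨
        - - w i δ             ≈⟨ -‿cong (antiperiodic i) ⟨
        - w i (δ ℕ.+ N)       ∎
      periodic′ : PeriodicRow (δ ℕ.+ N)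
      periodic′ i = trans (antiperiodic (shift N i))
        (trans (-‿cong (periodic i)) (sym (antiperiodic i)))

    rows : ∀ {δ} → Acc ℕ._<_ δ → AntiperiodicRow δ × PeriodicRow δ
    rows {δ} (acc rs) with δ ℕ.≤? N
    ... | yes δ≤N = rows-≤N δ≤N
    ... | no  δ≰N = ≡.subst (λ ε → AntiperiodicRow ε × PeriodicRow ε) (ℕ.m∸n+n≡m N≤δ)
                      -- With `o = 0` the bound `δ ∸ N < δ ∸ 0` computes to the required
                      -- `δ ∸ N < δ`.
                      (rows-+N (rows (rs (ℕ.∸-monoʳ-< {o = 0} (s≤s z≤n) N≤δ))))
      where
      N≤δ : N ℕ.≤ δ
      N≤δ = ℕ.≰⇒≥ δ≰N

    antiperiodicRow : ∀ δ → AntiperiodicRow δ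
    antiperiodicRow δ = proj₁ (rows (<-wellFounded δ))

    difference-+N : ∀ δ i → difference (δ ℕ.+ N) i ≈ - difference δ i
    difference-+N δ i = trans
      (+-cong (antiperiodicRow (2 ℕ.+ δ) i) (-‿cong (antiperiodicRow δ (ℤ.suc i))))
      (⁻¹-∙-comm _ _)

    QuiddityPeriod : ℕ → Set ℓ
    QuiddityPeriod n = ∀ i → w (shift n i) 2 ≈ w i 2

    -- The quiddity row of a finite frieze already has period `N`.
    quiddityPeriod-∸N : ∀ {n} → QuiddityPeriod (n ℕ.+ N) → QuiddityPeriod n
    quiddityPeriod-∸N {n} period i = begin
      w (shift n i) 2             ≈⟨ proj₂ (rows (<-wellFounded 2)) (shift n i) ⟨
      w (shift N (shift n i)) 2   ≡⟨ ≡.cong (λ j → w j 2) (shift-shift n N i) ⟩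
      w (shift (n ℕ.+ N) i) 2     ≈⟨ period i ⟩
      w i 2                       ∎

    DifferenceConstant : ℕ → Set ℓ
    DifferenceConstant δ = ∀ i → difference δ (ℤ.suc i) ≈ difference δ i

    difference-constant′ : ∀ {δ} → Acc ℕ._<_ δ → QuiddityPeriod (suc δ) → DifferenceConstant δ
    difference-constant′ {δ} (acc rs) period with ℕ.<-cmp (suc δ) N
    -- The strict inequality unfolds to `2 + δ ≤ N`, which says that the upper row of the difference
    -- still lies in the array.
    ... | tri< 1+δ<N _ _ = λ i → difference-suc δ i 1+δ<N (period i)
    ... | tri≈ _ ≡.refl _ = λ i → trans (value (ℤ.suc i)) (sym (value i))
      where
      value : ∀ i → difference (2 ℕ.+ K) i ≈ - 1# - 1#
      -- Row `N + 1` is the negative of the row of ones, and row `N - 1` consists of ones.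
      value i = +-cong (trans (antiperiodicRow 1 i) (-‿cong (ones i))) (-‿cong (last-ones (ℤ.suc i)))
    -- Lowering `δ` by `N` changes only the sign of the difference, and the lowered period `1 + δ′`
    -- is still positive.
    ... | tri> _ _ (s≤s N≤δ) = ≡.subst DifferenceConstant δ′+N≡δ λ i →
      trans (difference-+N δ′ (ℤ.suc i)) (trans (-‿cong (ih i)) (sym (difference-+N δ′ i)))
      where
      δ′ : ℕ
      δ′ = δ ℕ.∸ N
      δ′+N≡δ : δ′ ℕ.+ N ≡ δ
      δ′+N≡δ = ℕ.m∸n+n≡m N≤δ
      ih : DifferenceConstant δ′
      ih = difference-constant′ (rs (ℕ.∸-monoʳ-< {o = 0} (s≤s z≤n) N≤δ))
        (quiddityPeriod-∸N {suc δ′} (≡.subst (λ ε → QuiddityPeriod (suc ε)) (≡.sym δ′+N≡δ) period))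

    difference-constant : ∀ δ → QuiddityPeriod (suc δ) → DifferenceConstant δ
    difference-constant δ = difference-constant′ (<-wellFounded δ)

-- Rows as positions of the array.

HasRow : Shape → ℕ → Set
HasRow infinite     δ = ⊤
HasRow (finite N _) δ = δ ℕ.≤ N

hasRow-≤ : ∀ s {δ ε} → δ ℕ.≤ ε → HasRow s ε → HasRow s δ
hasRow-≤ infinite     δ≤ε _   = tt
hasRow-≤ (finite N _) δ≤ε ε≤N = ℕ.≤-trans δ≤ε ε≤N

hasRow-2 : ∀ s → HasRow s 2
hasRow-2 infinite     = tt
hasRow-2 (finite N h) = ℕ.≤-trans (ℕ.n≤1+n 2) h

diagonal : ∀ i d → d ℤ.- + 2 ≡ i ℤ.+ d ℤ.- + 2 ℤ.- i
diagonal = solve-∀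

≥row-0 : ∀ i δ → ℤ.- (+ 2) ℤ.≤ i ℤ.+ + δ ℤ.- + 2 ℤ.- i
≥row-0 i δ = ≡.subst (ℤ.- (+ 2) ℤ.≤_) (diagonal i (+ δ)) (ℤ.+-monoˡ-≤ (ℤ.- (+ 2)) (ℤ.+≤+ {n = δ} z≤n))

≤row-N : ∀ i {δ N} → δ ℕ.≤ N → i ℤ.+ + δ ℤ.- + 2 ℤ.- i ℤ.≤ + N ℤ.- + 2
≤row-N i {δ} {N} δ≤N =
  ≡.subst (ℤ._≤ + N ℤ.- + 2) (diagonal i (+ δ)) (ℤ.+-monoˡ-≤ (ℤ.- (+ 2)) (ℤ.+≤+ δ≤N))

-- The lower bound holds because `δ` is a natural number; `HasRow` supplies the upper bound of a
-- finite array.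
inArray : ∀ s {i j} δ → HasRow s δ → j ≡ i ℤ.+ + δ ℤ.- + 2 → InArray s i j
inArray infinite     {i} δ _   ≡.refl = ≥row-0 i δ
inArray (finite N _) {i} δ δ≤N ≡.refl = ≥row-0 i δ , ≤row-N i δ≤N

-- Translation of friezes and lattices into rows.

module _ {c ℓ₁ ℓ₂ ℓ₃ : Level} (ℝ : RealNumbers c ℓ₁ ℓ₂ ℓ₃) where
  open RealNumbers ℝ hiding (zero)
  open FriezeRows commutativeRing
  open import Algebra.Properties.Group (CommutativeRing.+-group commutativeRing) using (⁻¹-involutive)

  det₃-cong : ∀ {A B : Fin 3 → Fin 3 → Carrier} → (∀ r c → A r c ≈ B r c) → det₃ ℝ A ≈ det₃ ℝ B
  det₃-cong eq = +-cong (+-cong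
    (*-cong (eq r₀ r₀) (minor r₁ r₂ r₁ r₂))
    (-‿cong (*-cong (eq r₀ r₁) (minor r₁ r₂ r₀ r₂))))
    (*-cong (eq r₀ r₂) (minor r₁ r₂ r₀ r₁))
    where
    r₀ r₁ r₂ : Fin 3
    r₀ = zero
    r₁ = suc zero
    r₂ = suc (suc zero)
    minor : ∀ r r′ c c′ → _
    minor r r′ c c′ = +-cong (*-cong (eq r c) (eq r′ c′)) (-‿cong (*-cong (eq r c′) (eq r′ c)))

  module FriezeLattice {s : Shape} (F : Frieze ℝ s) {m : ℤ → ℤ → Carrier} (L : IsLattice ℝ F m) where
    open Frieze F
    open IsLattice L

    -- Reading the rows from the lattice rather than from `entry` makes them available beyond row
    -- `N` of a finite frieze.
    w : ℤ → ℕ → Carrier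
    w i δ = m i (i ℤ.+ + δ ℤ.- + 2)

    m≈w : ∀ {i i′ j} δ → i ≡ i′ → j ≡ i′ ℤ.+ + δ ℤ.- + 2 → m i j ≈ w i′ δ
    m≈w δ i≡i′ j≡ = reflexive (≡.cong₂ m i≡i′ j≡)

    entry≈w : ∀ {i i′ j} δ (p : InArray s i j) → i ≡ i′ → j ≡ i′ ℤ.+ + δ ℤ.- + 2 →
      entry i j p ≈ w i′ δ
    entry≈w {i} {i′} {j} δ p i≡i′ j≡ = trans (sym (extends i j p)) (m≈w δ i≡i′ j≡)

    w-zeros : ∀ i → w i 0 ≈ 0#
    w-zeros i = trans (sym (entry≈w 0 p ≡.refl eq)) (zeros i p)
      where
      eq : i ℤ.- + 2 ≡ i ℤ.+ + 0 ℤ.- + 2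
      eq = ≡.cong (ℤ._- + 2) (≡.sym (ℤ.+-identityʳ i))
      p : InArray s i (i ℤ.- + 2)
      p = inArray s 0 (hasRow-≤ s z≤n (hasRow-2 s)) eq

    w-ones : ∀ i → w i 1 ≈ 1#
    w-ones i = trans (sym (entry≈w 1 p ≡.refl (eq i))) (ones i p)
      where
      eq : ∀ i → i ℤ.- + 1 ≡ i ℤ.+ + 1 ℤ.- + 2
      eq = solve-∀
      p : InArray s i (i ℤ.- + 1)
      p = inArray s 1 (hasRow-≤ s (s≤s z≤n) (hasRow-2 s)) (eq i)

    w-unimodular : ∀ δ i → HasRow s (2 ℕ.+ δ) →
      w i (1 ℕ.+ δ) * w (shift 1 i) (1 ℕ.+ δ) ≈ 1# + w i (2 ℕ.+ δ) * w (shift 1 i) δ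
    w-unimodular δ i row = x-y≈z⇒x≈z+y (trans
      (sym (+-cong
        (*-cong (entry≈w (1 ℕ.+ δ) p₁ ≡.refl ≡.refl) (entry≈w (1 ℕ.+ δ) p₂ i+1 (eq₂ i (+ δ))))
        (-‿cong (*-cong (entry≈w (2 ℕ.+ δ) p₃ ≡.refl (eq₃ i (+ δ))) (entry≈w δ p₄ i+1 (eq₄ i (+ δ)))))))
      (rule i j p₁ p₂ p₃ p₄))
      where
      j : ℤ
      j = i ℤ.+ + (1 ℕ.+ δ) ℤ.- + 2
      i+1 : i ℤ.+ + 1 ≡ shift 1 i
      i+1 = ℤ.+-comm i (+ 1)
      eq₂ : ∀ i d → i ℤ.+ (+ 1 ℤ.+ d) ℤ.- + 2 ℤ.+ + 1 ≡ + 1 ℤ.+ i ℤ.+ (+ 1 ℤ.+ d) ℤ.- + 2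
      eq₂ = solve-∀
      eq₃ : ∀ i d → i ℤ.+ (+ 1 ℤ.+ d) ℤ.- + 2 ℤ.+ + 1 ≡ i ℤ.+ (+ 2 ℤ.+ d) ℤ.- + 2
      eq₃ = solve-∀
      eq₄ : ∀ i d → i ℤ.+ (+ 1 ℤ.+ d) ℤ.- + 2 ≡ + 1 ℤ.+ i ℤ.+ d ℤ.- + 2
      eq₄ = solve-∀
      row₁ : HasRow s (1 ℕ.+ δ)
      row₁ = hasRow-≤ s (ℕ.n≤1+n _) row
      p₁ : InArray s i j
      p₁ = inArray s (1 ℕ.+ δ) row₁ ≡.refl
      p₂ : InArray s (i ℤ.+ + 1) (j ℤ.+ + 1)
      p₂ = ≡.subst (λ i′ → InArray s i′ (j ℤ.+ + 1)) (≡.sym i+1)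
        (inArray s (1 ℕ.+ δ) row₁ (eq₂ i (+ δ)))
      p₃ : InArray s i (j ℤ.+ + 1)
      p₃ = inArray s (2 ℕ.+ δ) row (eq₃ i (+ δ))
      p₄ : InArray s (i ℤ.+ + 1) j
      p₄ = ≡.subst (λ i′ → InArray s i′ j) (≡.sym i+1)
        (inArray s δ (hasRow-≤ s (ℕ.n≤1+n _) row₁) (eq₄ i (+ δ)))

    w-tame : Tame ℝ F → ∀ δ i → HasRow s (4 ℕ.+ δ) → Singular
      (w i (2 ℕ.+ δ)) (w (shift 1 i) (1 ℕ.+ δ)) (w (shift 2 i) δ)
      (w i (3 ℕ.+ δ)) (w (shift 1 i) (2 ℕ.+ δ)) (w (shift 2 i) (1 ℕ.+ δ))
      (w i (4 ℕ.+ δ)) (w (shift 1 i) (3 ℕ.+ δ)) (w (shift 2 i) (2 ℕ.+ δ))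
    w-tame tame δ i row = det≈0⇒singular (trans (sym (det₃-cong block)) (tame i j p))
      where
      j : ℤ
      j = i ℤ.+ + (2 ℕ.+ δ) ℤ.- + 2
      -- The block entry at `r`, `c` lies in row `r + (2 - c) + δ`; `opposite c` is `2 - c` as a
      -- natural number. The lower left corner reaches the maximum `4 + δ`.
      depth : Fin 3 → Fin 3 → ℕ
      depth r c = toℕ r ℕ.+ toℕ (opposite c) ℕ.+ δ
      2-c : ∀ (c : Fin 3) → + toℕ (opposite c) ≡ + 2 ℤ.- + toℕ c
      2-c zero             = ≡.refl
      2-c (suc zero)       = ≡.refl
      2-c (suc (suc zero)) = ≡.refl
      eq : ∀ i d r c → i ℤ.+ (+ 2 ℤ.+ d) ℤ.- + 2 ℤ.+ r ≡ i ℤ.+ c ℤ.+ (r ℤ.+ (+ 2 ℤ.- c) ℤ.+ d) ℤ.- + 2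
      eq = solve-∀
      row-eq : ∀ r c → j ℤ.+ + toℕ r ≡ i ℤ.+ + toℕ c ℤ.+ + depth r c ℤ.- + 2
      row-eq r c = ≡.trans (eq i (+ δ) (+ toℕ r) (+ toℕ c))
        (≡.cong (λ d → i ℤ.+ + toℕ c ℤ.+ (+ toℕ r ℤ.+ d ℤ.+ + δ) ℤ.- + 2) (≡.sym (2-c c)))
      p : ∀ r c → InArray s (i ℤ.+ + toℕ c) (j ℤ.+ + toℕ r)
      p r c = inArray s (depth r c)
        (hasRow-≤ s (ℕ.+-monoˡ-≤ δ (ℕ.+-mono-≤ (toℕ≤pred[n] r) (toℕ≤pred[n] (opposite c)))) row)
        (row-eq r c)
      block : ∀ r c → entry (i ℤ.+ + toℕ c) (j ℤ.+ + toℕ r) (p r c) ≈ w (shift (toℕ c) i) (depth r c)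
      block r c = entry≈w (depth r c) (p r c) i+c
        (≡.trans (row-eq r c) (≡.cong (λ i′ → i′ ℤ.+ + depth r c ℤ.- + 2) i+c))
        where
        i+c : i ℤ.+ + toℕ c ≡ shift (toℕ c) i
        i+c = ≡.sym (shift≡+ (toℕ c) i)

    isTameFrieze : Tame ℝ F → IsTameFrieze (HasRow s) w
    isTameFrieze tame = record
      { band-≤     = hasRow-≤ s
      ; zeros      = w-zeros
      ; ones       = w-ones
      ; unimodular = w-unimodular
      ; tame       = w-tame tame
      }

    quiddity-periodic : ∀ {n} → Periodic ℝ n F → ∀ i → w (shift n i) 2 ≈ w i 2
    quiddity-periodic {n} periodic i =
      trans (sym (entry≈w 2 q (≡.sym (shift≡+ n i)) eq)) (trans (periodic i _ p q) (entry≈w 2 p ≡.refl ≡.refl))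
      where
      p : InArray s i (i ℤ.+ + 2 ℤ.- + 2)
      p = inArray s 2 (hasRow-2 s) ≡.refl
      move : ∀ i d → i ℤ.+ + 2 ℤ.- + 2 ℤ.+ d ≡ i ℤ.+ d ℤ.+ + 2 ℤ.- + 2
      move = solve-∀
      eq : i ℤ.+ + 2 ℤ.- + 2 ℤ.+ + n ≡ shift n i ℤ.+ + 2 ℤ.- + 2
      eq = ≡.trans (move i (+ n)) (≡.cong (λ i′ → i′ ℤ.+ + 2 ℤ.- + 2) (≡.sym (shift≡+ n i)))
      q : InArray s (i ℤ.+ + n) (i ℤ.+ + 2 ℤ.- + 2 ℤ.+ + n)
      q = inArray s 2 (hasRow-2 s) (move i (+ n))

  -- Constancy of the difference for both shapes, and the theorem.

  difference-constant : ∀ s (F : Frieze ℝ s) δ → (tame : Tame ℝ F) → Periodic ℝ (suc δ) F →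
    ∀ {m} (L : IsLattice ℝ F m) →
    let open TameFrieze (FriezeLattice.isTameFrieze F L tame) in
    ∀ i → difference δ (ℤ.suc i) ≈ difference δ i
  difference-constant infinite F δ tame periodic L i =
    TameFrieze.difference-suc (isTameFrieze tame) δ i tt (quiddity-periodic periodic i)
    where open FriezeLattice F L
  -- Matching on the proof of `3 ≤ N` turns `N` into `3 + K`, so the last two rows are `2 + K` and
  -- `3 + K`.
  difference-constant s@(finite _ (s≤s (s≤s (s≤s {n = K} _)))) F δ tame periodic {m} L =
    FiniteLattice.difference-constant (isTameFrieze tame) last-ones last-zeros mirror translation
      δ (quiddity-periodic periodic)
    where
    open FriezeLattice F L
    open Frieze F using (end)
    N : ℕ
    N = 3 ℕ.+ K
    mirror₀ : ∀ i j → m i j ≈ - m (j ℤ.+ + 2) (i ℤ.- + 2)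
    mirror₀ = proj₁ (IsLattice.mirrors L)
    mirrorₙ : ∀ i j → m i j ≈ - m (j ℤ.- + N ℤ.+ + 2) (i ℤ.+ + N ℤ.- + 2)
    mirrorₙ = proj₂ (IsLattice.mirrors L)

    last-ones : ∀ i → w i (2 ℕ.+ K) ≈ 1#
    last-ones i = trans (sym (entry≈w (2 ℕ.+ K) p ≡.refl (eq i (+ K)))) (proj₁ end i p)
      where
      eq : ∀ i k → i ℤ.+ (+ 3 ℤ.+ k) ℤ.- + 3 ≡ i ℤ.+ (+ 2 ℤ.+ k) ℤ.- + 2
      eq = solve-∀
      p : InArray s i (i ℤ.+ + N ℤ.- + 3)
      p = inArray s {i} (2 ℕ.+ K) (ℕ.n≤1+n _) (eq i (+ K))

    last-zeros : ∀ i → w i N ≈ 0#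
    last-zeros i = trans (sym (entry≈w {i} N p ≡.refl ≡.refl)) (proj₂ end i p)
      where
      p : InArray s i (i ℤ.+ + N ℤ.- + 2)
      p = inArray s {i} N ℕ.≤-refl ≡.refl

    -- The second mirror relation reflects across row `N`, taking row `N + δ` to row `N - δ`, here
    -- called `ε`.
    mirror : ∀ δ ε i → δ ℕ.+ ε ≡ N → w i (δ ℕ.+ N) ≈ - w (shift δ i) ε
    mirror δ ε i δ+ε≡N = trans (mirrorₙ i _) (-‿cong (m≈w ε
      (≡.trans (eq₁ i (+ δ) (+ N)) (≡.sym (shift≡+ δ i)))
      (≡.trans (≡.cong (λ n → i ℤ.+ + n ℤ.- + 2) (≡.sym δ+ε≡N))
        (≡.trans (eq₂ i (+ δ) (+ ε))
          (≡.cong (λ i′ → i′ ℤ.+ + ε ℤ.- + 2) (≡.sym (shift≡+ δ i)))))))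
      where
      eq₁ : ∀ i d n → i ℤ.+ (d ℤ.+ n) ℤ.- + 2 ℤ.- n ℤ.+ + 2 ≡ i ℤ.+ d
      eq₁ = solve-∀
      eq₂ : ∀ i d e → i ℤ.+ (d ℤ.+ e) ℤ.- + 2 ≡ i ℤ.+ d ℤ.+ e ℤ.- + 2
      eq₂ = solve-∀

    -- Two reflections compose to a translation, and their signs cancel.
    translation : ∀ δ i → w i (δ ℕ.+ N ℕ.+ N) ≈ w (shift N i) δ
    translation δ i = trans (mirrorₙ i _) (trans (-‿cong (mirror₀ _ _)) (trans (⁻¹-involutive _)
      (m≈w δ
        (≡.trans (eq₁ i (+ N)) (≡.sym (shift≡+ N i)))
        (≡.trans (eq₂ i (+ δ) (+ N))
          (≡.cong (λ i′ → i′ ℤ.+ + δ ℤ.- + 2) (≡.sym (shift≡+ N i)))))))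
      where
      eq₁ : ∀ i n → i ℤ.+ n ℤ.- + 2 ℤ.+ + 2 ≡ i ℤ.+ n
      eq₁ = solve-∀
      eq₂ : ∀ i d n → i ℤ.+ (d ℤ.+ n ℤ.+ n) ℤ.- + 2 ℤ.- n ℤ.+ + 2 ℤ.- + 2 ≡ i ℤ.+ n ℤ.+ d ℤ.- + 2
      eq₂ = solve-∀

theorem2p2 : ∀ {c ℓ₁ ℓ₂ ℓ₃ : Level} (ℝ : RealNumbers c ℓ₁ ℓ₂ ℓ₃) →
    let open RealNumbers ℝ in
    ∀ (s : Shape) (F : Frieze ℝ s) (n : ℕ) .{{_ : NonZero n}} →
    Tame ℝ F → Periodic ℝ n F →
    ∀ (m : ℤ → ℤ → Carrier) → IsLattice ℝ F m →
    ∀ (k : ℤ) →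
    m (+ 1) (+ n) - m (+ 2) (+ n ℤ.- + 1)
    ≈ m (k ℤ.+ + 1) (k ℤ.+ + n) - m (k ℤ.+ + 2) (k ℤ.+ + n ℤ.- + 1)
-- Both sides equal the difference at `+ 0`. For `k = + 0` the index sums compute, so `at-k` applies
-- to the left side as it stands.
theorem2p2 ℝ s F (suc δ) tame periodic m L k = trans (at-k (+ 0)) (sym (at-k k))
  where
  open RealNumbers ℝ
  open FriezeRows commutativeRing using (constant; module TameFrieze)
  open FriezeLattice ℝ F L using (isTameFrieze; m≈w)
  open TameFrieze (isTameFrieze tame) using (difference)
  eq₁ : ∀ k d → k ℤ.+ (+ 1 ℤ.+ d) ≡ k ℤ.+ + 1 ℤ.+ (+ 2 ℤ.+ d) ℤ.- + 2
  eq₁ = solve-∀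
  eq₂ : ∀ k → k ℤ.+ + 2 ≡ + 1 ℤ.+ (k ℤ.+ + 1)
  eq₂ = solve-∀
  eq₃ : ∀ k d → k ℤ.+ (+ 1 ℤ.+ d) ℤ.- + 1 ≡ + 1 ℤ.+ (k ℤ.+ + 1) ℤ.+ d ℤ.- + 2
  eq₃ = solve-∀
  at-k : ∀ k → m (k ℤ.+ + 1) (k ℤ.+ + suc δ) - m (k ℤ.+ + 2) (k ℤ.+ + suc δ ℤ.- + 1) ≈ difference δ (+ 0)
  at-k k = trans
    -- With `n = 1 + δ`, the two entries lie in rows `n + 1` and `n - 1`, at base points `k + 1` and
    -- `k + 2`.
    (+-cong (m≈w (2 ℕ.+ δ) ≡.refl (eq₁ k (+ δ))) (-‿cong (m≈w δ (eq₂ k) (eq₃ k (+ δ)))))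
    (constant (difference δ) (difference-constant ℝ s F δ tame periodic L) (k ℤ.+ + 1))
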